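{- Let $n\ge k>0$ be integers, let $\lambda,\mu,\nu$ be binary sequences of length $n$ with exactly $k$ ones, let $P^{\nu,\overline\Omega}_{\lambda\mu}$ be a refined puzzle of a puzzle $P^{\nu,\Omega}_{\lambda\mu}$ (with respect to an atomic refinement $\overline\Omega$ of $\Omega$), and let $I^{\nu,\overline\Omega}_{\lambda\mu}\subseteq\mathbb{F}_3[x_1,\dots,x_N]$, $N=\frac{3n(n+1)}2$, be the atomic puzzle ideal of $P^{\nu,\overline\Omega}_{\lambda\mu}$. Then there is a one-one correspondence (bijection) between the $\mathbb{F}_3$-variety $V(I^{\nu,\overline\Omega}_{\lambda\mu})\subseteq\mathbb{F}_3^N$ and the set $S(P^{\nu,\overline\Omega}_{\lambda\mu})$ of tilings of $\bigtriangleup^\nu_{\lambda\mu}$ with $\overline\Omega$.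
   Context: **Puzzles.** $\bigtriangleup^{\nu}_{\lambda\mu}$ is the upward equilateral triangle of side length $n$, subdivided into $n^2$ unit triangles with $N=\frac{3n(n+1)}{2}$ unit intervals as sides; the unit intervals of its left, right and bottom sides carry the values of $\lambda,\mu,\nu$ respectively, each side read from left to right. An $\mathbb{F}_q$-valued puzzle piece is a convex polygon whose sides are parallel to sides of the big triangle and of integer length, with an $\mathbb{F}_q$-value on each unit interval of its boundary. A tiling of a piece $p$ (possibly $\bigtriangleup^\nu_{\lambda\mu}$) with a set of pieces is a covering of $p$ by translates of pieces of the set (repetition allowed; no rotation or mirroring) without overlaps or gaps, such that values on common edges of adjacent pieces match and values on the boundary of $p$ match. $\mathbb{F}_2$-values are embedded in $\mathbb{F}_3$ as $0,1$. A puzzle $P^{\nu,\Omega}_{\lambda\mu}$ consists of $\bigtriangleup^\nu_{\lambda\mu}$ and a set $\Omega$ of $\mathbb{F}_2$-valued pieces. **Atomic refinement.** An atomic piece is an $\mathbb{F}_3$-valued unit triangle whose three values sum to $0$ in $\mathbb{F}_3$. $\Omega$ is refinable if each $p\in\Omega$ has a tiling $\overline t_p$ with atomic pieces; this is assumed throughout. Given a choice of such tilings, the atomic refinement $\overline\Omega$ of $\Omega$ induced by $\{\overline t_p\}$ is the set of all atomic pieces appearing in the tilings $\overline t_p$, $p\in\Omega$. The refined puzzle $P^{\nu,\overline\Omega}_{\lambda\mu}$ consists of $\bigtriangleup^\nu_{\lambda\mu}$ and $\overline\Omega$; $S(P^{\nu,\overline\Omega}_{\lambda\mu})$ is the set of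 tilings of $\bigtriangleup^\nu_{\lambda\mu}$ with $\overline\Omega$. **Distinguishing polynomials.** An upward (downward) atomic piece is identified with the vector of values of its left, right, bottom (left, top, right) sides. An upward (downward) distinguishing polynomial w.r.t. $\overline\Omega$ is $f\in\mathbb{F}_3[x,y,z]/\langle x^3-x,y^3-y,z^3-z\rangle$ such that for each upward (downward) atomic piece $a$: $f(a)=0$ iff $a\in\overline\Omega$. **Atomic puzzle ideal.** Introduce variables $x_1,\dots,x_N$, one per unit interval, and fix an upward and a downward distinguishing polynomial w.r.t. $\overline\Omega$. Set: $\mathcal F_1=\{x_i^3-x_i: 1\le i\le N\}$; $\mathcal F_2=\{x_{lj}-\lambda_j,\ x_{rj}-\mu_j,\ x_{bj}-\nu_j: 1\le j\le n\}$, where $x_{lj},x_{rj},x_{bj}$ are the variables of the $j$-th intervals (left to right) of the left, right, bottom sides; $\mathcal F_3$ = for each unit triangle, the sum of its three side variables; $\mathcal F_4$ = for each upward unit triangle, the upward distinguishing polynomial evaluated at its left, right, bottom variables, and for each downward unit triangle, the downward one evaluated at its left, top, right variables. The atomic puzzle ideal is the ideal of $\mathbb{F}_3[x_1,\dots,x_N]$ generated by $\mathcal F_1\cup\mathcal F_2\cup\mathcal F_3\cup\mathcal F_4$. $V(\cdot)$ is the set of common zeros in $\mathbb{F}_3^N$. -}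

module Defs where

open import Data.Bool.Base using (if_then_else_)
open import Data.Fin.Base using (Fin; zero; suc; toℕ; fromℕ<; inject₁; splitAt)
open import Data.Fin.Patterns using (0F; 1F; 2F)
open import Data.Fin.Properties using (_≟_; toℕ<n; toℕ≤pred[n]; toℕ-fromℕ<; fromℕ<-toℕ; +↔⊎; *↔×)
open import Data.List.Base as List using (List; []; _∷_; [_]; _++_; cartesianProductWith)
open import Data.List.Relation.Unary.All using (All; []; _∷_)
open import Data.Nat.Base using (ℕ; zero; suc; _+_; _*_; _∸_; _^_; _/_; _≤_; _<_; z≤n; s≤s; z<s)
open import Data.Nat.DivMod using (_mod_; m*n/n≡m)
import Data.Nat.Properties as ℕ
open import Data.Nat.Tactic.RingSolver using (solve-∀)
open import Data.Product.Base using (Σ-syntax; ∃-syntax; _×_; _,_; proj₁; proj₂)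
open import Data.Product.Function.NonDependent.Propositional using (_×-↔_)
open import Data.Sum.Base using (_⊎_; inj₁; inj₂)
open import Data.Sum.Function.Propositional using (_⊎-↔_)
open import Data.Vec.Base as Vec using (Vec; []; _∷_; lookup; _[_]≔_)
open import Data.Vec.Properties using (≡-dec)
open import Function.Bundles using (_↔_; _⇔_; mk↔ₛ′; module Inverse)
open import Function.Properties.Inverse using (↔-refl; ↔-sym; ↔-trans)
open import Level using (0ℓ) renaming (suc to lsuc)
open import Relation.Binary.Bundles using (Setoid)
import Relation.Binary.Construct.On as On
open import Relation.Binary.PropositionalEquality using (_≡_; refl; sym; trans; cong; subst; setoid)
open import Relation.Nullary using (yes; no; does; contradiction)
open import Relation.Nullary.Decidable using (recompute)
open import Relation.Unary using (Pred; _∈_)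
open import Relation.Unary.Relation.Binary.Equality using (≐-setoid)

-- Used for q = 2 and q = 3 only.
𝔽 : ℕ → Set
𝔽 q = Fin q

embed : 𝔽 2 → 𝔽 3
embed = inject₁

infixl 6 _+₃_
infixl 7 _*₃_

_+₃_ _*₃_ : 𝔽 3 → 𝔽 3 → 𝔽 3
a +₃ b = (toℕ a + toℕ b) mod 3
a *₃ b = (toℕ a * toℕ b) mod 3

_^₃_ : 𝔽 3 → ℕ → 𝔽 3
a ^₃ zero  = 1F
a ^₃ suc k = a *₃ (a ^₃ k)

-₃_ : 𝔽 3 → 𝔽 3
-₃ a = (3 ∸ toℕ a) mod 3

ones : ∀ {n} → Vec (𝔽 2) n → ℕ
ones = Vec.count (_≟ 1F)

-- The point (x , y) stands for x·e₁ + y·e₂, where e₁ points to the right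
-- and e₂ to the upper right, at an angle of 60°.

Point : Set
Point = ℕ × ℕ

data Cell : Set where
  up   : Point → Cell   -- lower left corner at the given point
  down : Point → Cell   -- shares its left side with the right side of  up  there

corners : Cell → List Point
corners (up   (x , y)) = (x , y) ∷ (suc x , y) ∷ (x , suc y) ∷ []
corners (down (x , y)) = (suc x , y) ∷ (x , suc y) ∷ (suc x , suc y) ∷ []

-- Every unit interval of the lattice is a side of exactly one upward unit
-- triangle and is named by that triangle and the side it forms.
data Side : Set where
  left right bottom : Side

Edge : Set
Edge = Side × Point

ends : Edge → List Point
ends (left   , x , y) = (x , y) ∷ (x , suc y) ∷ []
ends (right  , x , y) = (suc x , y) ∷ (x , suc y) ∷ []
ends (bottom , x , y) = (x , y) ∷ (suc x , y) ∷ []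

_+ᵖ_ : Point → Point → Point
(a , b) +ᵖ (x , y) = a + x , b + y

_+ᶜ_ : Point → Cell → Cell
v +ᶜ up   w = up   (v +ᵖ w)
v +ᶜ down w = down (v +ᵖ w)

_+ᵉ_ : Point → Edge → Edge
v +ᵉ (s , w) = s , (v +ᵖ w)

-- A convex polygon with sides parallel to those of the big triangle is,
-- up to translation, a hexagon some of whose sides may have length 0.  It
-- is determined by its side lengths, which have to satisfy the two
-- equations saying that its boundary closes up.  The last three fields
-- say that its width is positive in each of the three directions, i.e.
-- that it does not degenerate to a segment or a point.
record Shape : Set where
  field
    bot top loL upL loR upR : ℕ      -- loL = lower left side, etc.
    .closed₁ : loL + bot ≡ top + upR
    .closed₂ : loL + upL ≡ loR + upR
    .width₁  : 0 < loL + bot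
    .width₂  : 0 < loR + upR
    .width₃  : 0 < bot + loR

-- The polygon is positioned so that min x = min y = 0.
record _∈ˢ_ (P : Point) (s : Shape) : Set where
  constructor inPolygon
  open Shape s
  field
    x≤   : proj₁ P ≤ loL + bot
    y≤   : proj₂ P ≤ loR + upR
    ≤x+y : loL ≤ proj₁ P + proj₂ P
    x+y≤ : proj₁ P + proj₂ P ≤ loL + bot + loR

_∈ᶜ_ : Cell → Shape → Set
u ∈ᶜ s = All (_∈ˢ s) (corners u)

-- Values on the unit intervals of each side, read from left to right.
record Piece (q : ℕ) : Set where
  field
    shape : Shape
  open Shape shape public
  field
    botV : Vec (𝔽 q) bot
    topV : Vec (𝔽 q) top
    loLV : Vec (𝔽 q) loL
    upLV : Vec (𝔽 q) upL
    loRV : Vec (𝔽 q) loR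
    upRV : Vec (𝔽 q) upR

-- BoundaryValue p e c: the unit interval e lies on the boundary of p and
-- carries the value c.  The lower left and upper right sides descend from
-- left to right, which accounts for the ∸.
data BoundaryValue {q} (p : Piece q) : Edge → 𝔽 q → Set where
  botB : let open Piece p in (i : Fin bot) →
         BoundaryValue p (bottom , loL + toℕ i , 0) (lookup botV i)
  topB : let open Piece p in (i : Fin top) →
         BoundaryValue p (bottom , toℕ i , loR + upR) (lookup topV i)
  loLB : let open Piece p in (i : Fin loL) →
         BoundaryValue p (right , toℕ i , loL ∸ suc (toℕ i)) (lookup loLV i)
  upLB : let open Piece p in (i : Fin upL) →
         BoundaryValue p (left , 0 , loL + toℕ i) (lookup upLV i)
  loRB : let open Piece p in (i : Fin loR) →
         BoundaryValue p (left , loL + bot , toℕ i) (lookup loRV i)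
  upRB : let open Piece p in (i : Fin upR) →
         BoundaryValue p (right , top + toℕ i , (loR + upR) ∸ suc (toℕ i)) (lookup upRV i)

embedPiece : Piece 2 → Piece 3
embedPiece p = record
  { shape = shape
  ; botV = Vec.map embed botV ; topV = Vec.map embed topV
  ; loLV = Vec.map embed loLV ; upLV = Vec.map embed upLV
  ; loRV = Vec.map embed loRV ; upRV = Vec.map embed upRV }
  where open Piece p

triangle : ∀ n → .(0 < n) → Shape
triangle n 0<n = record
  { bot = n ; top = 0 ; loL = 0 ; upL = n ; loR = 0 ; upR = n
  ; closed₁ = refl ; closed₂ = refl
  ; width₁ = 0<n ; width₂ = 0<n ; width₃ = ℕ.m≤n⇒m≤n+o 0 0<n }

-- △ l r b has the values l, r, b on its left, right and bottom sides.
△ : ∀ {q n} → .(0 < n) → (l r b : Vec (𝔽 q) n) → Piece q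
△ {n = n} 0<n l r b = record
  { shape = triangle n 0<n
  ; botV = b ; topV = [] ; loLV = [] ; upLV = l ; loRV = [] ; upRV = r }

upTri : ∀ {q} (l r b : 𝔽 q) → Piece q
upTri l r b = △ z<s (l ∷ []) (r ∷ []) (b ∷ [])

downTri : ∀ {q} (l t r : 𝔽 q) → Piece q
downTri l t r = record
  { shape = record
    { bot = 0 ; top = 1 ; loL = 1 ; upL = 0 ; loR = 1 ; upR = 0
    ; closed₁ = refl ; closed₂ = refl ; width₁ = z<s ; width₂ = z<s ; width₃ = z<s }
  ; botV = [] ; topV = t ∷ [] ; loLV = l ∷ [] ; upLV = [] ; loRV = r ∷ [] ; upRV = [] }

-- Since all pieces are positioned with min x = min y = 0, a translate that
-- lies inside a piece in standard position is a translate by some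
-- (a , b) with a, b ≥ 0.
record Translate (q : ℕ) : Set where
  constructor _at_
  field
    piece  : Piece q
    vector : Point

infix 5 _at_

_covers_ : ∀ {q} → Translate q → Cell → Set
(p at v) covers u = ∃[ u₀ ] u₀ ∈ᶜ Piece.shape p × u ≡ v +ᶜ u₀

HasBoundaryValue : ∀ {q} → Translate q → Edge → 𝔽 q → Set
HasBoundaryValue (p at v) e c = ∃[ e₀ ] BoundaryValue p e₀ c × e ≡ v +ᵉ e₀

-- A tiling is a set of translates.
record Tiling {q} (p : Piece q) (Π : Pred (Piece q) 0ℓ) : Set₁ where
  field
    tiles         : Pred (Translate q) 0ℓ
    allowed       : ∀ {t} → t ∈ tiles → Translate.piece t ∈ Π
    inside        : ∀ {t u} → t ∈ tiles → t covers u → u ∈ᶜ Piece.shape p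
    noGaps        : ∀ {u} → u ∈ᶜ Piece.shape p → ∃[ t ] t ∈ tiles × t covers u
    noOverlaps    : ∀ {t t′ u} → t ∈ tiles → t′ ∈ tiles →
                    t covers u → t′ covers u → t ≡ t′
    edgesMatch    : ∀ {t t′ e c c′} → t ∈ tiles → t′ ∈ tiles →
                    HasBoundaryValue t e c → HasBoundaryValue t′ e c′ → c ≡ c′
    boundaryMatch : ∀ {t e c c′} → t ∈ tiles →
                    BoundaryValue p e c → HasBoundaryValue t e c′ → c ≡ c′

-- Two tilings are equal when they consist of the same translates.
Tilings : ∀ {q} → Piece q → Pred (Piece q) 0ℓ → Setoid (lsuc 0ℓ) 0ℓ
Tilings {q} p Π = On.setoid (≐-setoid (Translate q) 0ℓ) (Tiling.tiles {p = p} {Π = Π})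

data Atomic : Pred (Piece 3) 0ℓ where
  upAtomic   : ∀ {l r b} → l +₃ r +₃ b ≡ 0F → Atomic (upTri l r b)
  downAtomic : ∀ {l t r} → l +₃ t +₃ r ≡ 0F → Atomic (downTri l t r)

-- A choice of one atomic tiling for each piece of Ω; irrelevance makes the
-- choice independent of the proof of membership.
AtomicTilings : Pred (Piece 2) 0ℓ → Set₁
AtomicTilings Ω = ∀ p → .(p ∈ Ω) → Tiling (embedPiece p) Atomic

refinement : (Ω : Pred (Piece 2) 0ℓ) → AtomicTilings Ω → Pred (Piece 3) 0ℓ
refinement Ω τ a = ∃[ p ] Σ[ p∈Ω ∈ p ∈ Ω ] ∃[ v ] (a at v) ∈ Tiling.tiles (τ p p∈Ω)

Monomial : ℕ → Set
Monomial N = Vec ℕ N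

-- Finite formal sums of terms; two of them are the same polynomial when
-- all coefficients agree.
Poly : ℕ → Set
Poly N = List (𝔽 3 × Monomial N)

coeff : ∀ {N} → Poly N → Monomial N → 𝔽 3
coeff []            m = 0F
coeff ((c , k) ∷ f) m = if does (≡-dec ℕ._≟_ k m) then c +₃ coeff f m else coeff f m

infix  4 _≈ᴾ_
infixl 6 _+ᴾ_ _-ᴾ_
infixl 7 _*ᴾ_
infixr 8 _^ᴾ_

_≈ᴾ_ : ∀ {N} → Poly N → Poly N → Set
f ≈ᴾ g = ∀ m → coeff f m ≡ coeff g m

con : ∀ {N} → 𝔽 3 → Poly N
con c = [ (c , Vec.replicate _ 0) ]

var : ∀ {N} → Fin N → Poly N
var i = [ (1F , Vec.replicate _ 0 [ i ]≔ 1) ]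

_+ᴾ_ _-ᴾ_ _*ᴾ_ : ∀ {N} → Poly N → Poly N → Poly N
f +ᴾ g = f ++ g
f -ᴾ g = f ++ List.map (λ (c , m) → -₃ c , m) g
f *ᴾ g = cartesianProductWith (λ (c , m) (d , k) → c *₃ d , Vec.zipWith _+_ m k) f g

_^ᴾ_ : ∀ {N} → Poly N → ℕ → Poly N
f ^ᴾ zero  = con 1F
f ^ᴾ suc k = f *ᴾ (f ^ᴾ k)

eval : ∀ {N} → Poly N → Vec (𝔽 3) N → 𝔽 3
eval f a = List.foldr (λ (c , m) s → c *₃ evalMonomial m +₃ s) 0F f
  where evalMonomial = λ m → Vec.foldr′ _*₃_ 1F (Vec.zipWith _^₃_ a m)

substitute : ∀ {M N} → Poly M → Vec (Poly N) M → Poly N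
substitute f gs = List.foldr (λ (c , m) s → con c *ᴾ substMonomial m +ᴾ s) (con 0F) f
  where substMonomial = λ m → Vec.foldr′ _*ᴾ_ (con 1F) (Vec.zipWith _^ᴾ_ gs m)

data Ideal {N} (G : Pred (Poly N) 0ℓ) : Pred (Poly N) 0ℓ where
  generator : ∀ {g} → g ∈ G → g ∈ Ideal G
  zeroᴵ     : con 0F ∈ Ideal G
  sumᴵ      : ∀ {f g} → f ∈ Ideal G → g ∈ Ideal G → f +ᴾ g ∈ Ideal G
  multipleᴵ : ∀ h {f} → f ∈ Ideal G → h *ᴾ f ∈ Ideal G
  respᴵ     : ∀ {f g} → f ≈ᴾ g → f ∈ Ideal G → g ∈ Ideal G

-- The common zeros in 𝔽₃ᴺ; points are equal when their coordinates are.
Variety : ∀ {N} → Pred (Poly N) 0ℓ → Setoid 0ℓ 0ℓ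
Variety {N} I = On.setoid (setoid (Vec (𝔽 3) N)) (proj₁ {B = λ a → ∀ {f} → f ∈ I → eval f a ≡ 0F})

-- Elements of 𝔽₃[x,y,z]/⟨x³-x, y³-y, z³-z⟩ are given by representatives.

UpDistinguishing DownDistinguishing : Pred (Piece 3) 0ℓ → Poly 3 → Set
UpDistinguishing Ω̄ f = ∀ l r b → Atomic (upTri l r b) →
  eval f (l ∷ r ∷ b ∷ []) ≡ 0F ⇔ upTri l r b ∈ Ω̄
DownDistinguishing Ω̄ f = ∀ l t r → Atomic (downTri l t r) →
  eval f (l ∷ t ∷ r ∷ []) ≡ 0F ⇔ downTri l t r ∈ Ω̄

record Interval (s : Shape) : Set where
  constructor interval
  field
    edge    : Edge
    .inside : All (_∈ˢ s) (ends edge)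

private
  module _ {P : Pred Point 0ℓ} {A B C : Point} where
    all₁₂ : All P (A ∷ B ∷ C ∷ []) → All P (A ∷ B ∷ [])
    all₁₂ (a ∷ b ∷ c ∷ []) = a ∷ b ∷ []
    all₁₃ : All P (A ∷ B ∷ C ∷ []) → All P (A ∷ C ∷ [])
    all₁₃ (a ∷ b ∷ c ∷ []) = a ∷ c ∷ []
    all₂₃ : All P (A ∷ B ∷ C ∷ []) → All P (B ∷ C ∷ [])
    all₂₃ (a ∷ b ∷ c ∷ []) = b ∷ c ∷ []

-- The sides of a unit triangle: left, right, bottom for an upward one and
-- left, top, right for a downward one.
sides : ∀ {s} u → .(u ∈ᶜ s) → Vec (Interval s) 3
sides (up (x , y)) u∈s =
    interval (left   , x , y) (all₁₃ u∈s)
  ∷ interval (right  , x , y) (all₂₃ u∈s)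
  ∷ interval (bottom , x , y) (all₁₂ u∈s)
  ∷ []
sides (down (x , y)) u∈s =
    interval (right  , x , y)     (all₁₂ u∈s)
  ∷ interval (bottom , x , suc y) (all₂₃ u∈s)
  ∷ interval (left   , suc x , y) (all₁₃ u∈s)
  ∷ []

∈triangle : ∀ {n x y} .{0<n : 0 < n} → x + y ≤ n → (x , y) ∈ˢ triangle n 0<n
∈triangle {n} {x} {y} h = inPolygon
  (ℕ.≤-trans (ℕ.m≤m+n x y) h) (ℕ.≤-trans (ℕ.m≤n+m y x) h)
  z≤n (ℕ.≤-trans h (ℕ.m≤m+n n 0))

intervalOf : ∀ {n} .{0<n : 0 < n} s x y → .(x + y < n) → Interval (triangle n 0<n)
intervalOf {n} s x y h = interval (s , x , y) (go s h)
  where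
  h₀ : x + y < n → x + y ≤ n
  h₀ = ℕ.<⇒≤
  h₁ : x + y < n → x + suc y ≤ n
  h₁ = ℕ.≤-trans (ℕ.≤-reflexive (ℕ.+-suc x y))
  go : ∀ s .{0<n} → x + y < n → All (_∈ˢ triangle n 0<n) (ends (s , x , y))
  go left   h = ∈triangle (h₀ h) ∷ ∈triangle (h₁ h) ∷ []
  go right  h = ∈triangle h ∷ ∈triangle (h₁ h) ∷ []
  go bottom h = ∈triangle (h₀ h) ∷ ∈triangle h ∷ []

-- The j-th unit interval, from left to right, of each side of the big
-- triangle.
module _ {n} .{0<n : 0 < n} (j : Fin n) where
  leftInterval rightInterval bottomInterval : Interval (triangle n 0<n)
  leftInterval   = intervalOf left 0 (toℕ j) (toℕ<n j)
  rightInterval  = intervalOf right (toℕ j) (n ∸ suc (toℕ j))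
    (ℕ.≤-reflexive (ℕ.m+[n∸m]≡n (toℕ<n j)))
  bottomInterval = intervalOf bottom (toℕ j) 0
    (ℕ.≤-trans (ℕ.≤-reflexive (cong suc (ℕ.+-identityʳ (toℕ j)))) (toℕ<n j))

#intervals : ℕ → ℕ
#intervals n = 3 * n * (n + 1) / 2

-- The variables x₁, …, x_N are attached to the unit intervals by an
-- arbitrary numbering of the latter.
Numbering : ∀ n → .(0 < n) → Set
Numbering n 0<n = Interval (triangle n 0<n) ↔ Fin (#intervals n)

module _ {n} .{0<n : 0 < n} (numbering : Numbering n 0<n)
         (la mu nu : Vec (𝔽 2) n) (f↑ f↓ : Poly 3) where

  private
    x : Interval (triangle n 0<n) → Poly (#intervals n)
    x e = var (Inverse.to numbering e)

  data 𝓕 : Pred (Poly (#intervals n)) 0ℓ where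
    𝓕₁  : ∀ i → var i ^ᴾ 3 -ᴾ var i ∈ 𝓕
    𝓕₂ˡ : ∀ j → x (leftInterval j)   -ᴾ con (embed (lookup la j)) ∈ 𝓕
    𝓕₂ʳ : ∀ j → x (rightInterval j)  -ᴾ con (embed (lookup mu j)) ∈ 𝓕
    𝓕₂ᵇ : ∀ j → x (bottomInterval j) -ᴾ con (embed (lookup nu j)) ∈ 𝓕
    𝓕₃  : ∀ u (u∈△ : u ∈ᶜ triangle n 0<n) →
          Vec.foldr′ _+ᴾ_ (con 0F) (Vec.map x (sides u u∈△)) ∈ 𝓕
    𝓕₄↑ : ∀ v (u∈△ : up v ∈ᶜ triangle n 0<n) →
          substitute f↑ (Vec.map x (sides (up v) u∈△)) ∈ 𝓕
    𝓕₄↓ : ∀ v (u∈△ : down v ∈ᶜ triangle n 0<n) →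
          substitute f↓ (Vec.map x (sides (down v) u∈△)) ∈ 𝓕

  atomicPuzzleIdeal : Pred (Poly (#intervals n)) 0ℓ
  atomicPuzzleIdeal = Ideal 𝓕

-- The rest shows that numberings exist: there are 3n(n+1)/2 unit intervals.

private
  record Position (n : ℕ) : Set where
    constructor position
    field
      px py : ℕ
      .inside : px + py < n

  #positions : ℕ → ℕ
  #positions zero    = 0
  #positions (suc n) = #positions n + suc n

  split : ∀ {n} → Position (suc n) ↔ (Position n ⊎ Fin (suc n))
  split {n} = mk↔ₛ′ to from to∘from from∘to
    where
    to : Position (suc n) → Position n ⊎ Fin (suc n)
    to (position x y h) with x + y ℕ.<? n
    ... | yes x+y<n = inj₁ (position x y x+y<n)
    ... | no  _     = inj₂ (fromℕ< {x} (ℕ.≤-trans (s≤s (ℕ.m≤m+n x y)) (recompute (_ ℕ.<? _) h)))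

    from : Position n ⊎ Fin (suc n) → Position (suc n)
    from (inj₁ (position x y h)) = position x y (ℕ.m≤n⇒m≤1+n h)
    from (inj₂ i) = position (toℕ i) (n ∸ toℕ i)
      (s≤s (ℕ.≤-reflexive (ℕ.m+[n∸m]≡n (toℕ≤pred[n] i))))

    position-≡ : ∀ {x y y′} .{h : x + y < suc n} .{h′ : x + y′ < suc n} →
                 y ≡ y′ → position x y h ≡ position x y′ h′
    position-≡ refl = refl

    to∘from : ∀ p → to (from p) ≡ p
    to∘from (inj₁ (position x y h)) with x + y ℕ.<? n
    ... | yes _    = refl
    ... | no x+y≮n = contradiction (recompute (_ ℕ.<? _) h) x+y≮n
    to∘from (inj₂ i) with toℕ i + (n ∸ toℕ i) ℕ.<? n
    ... | yes lt = contradiction (ℕ.m+[n∸m]≡n (toℕ≤pred[n] i)) (ℕ.<⇒≢ lt)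
    ... | no _   = cong inj₂ (fromℕ<-toℕ i _)

    from∘to : ∀ p → from (to p) ≡ p
    from∘to (position x y h) with x + y ℕ.<? n
    ... | yes _    = refl
    ... | no x+y≮n = eq (toℕ-fromℕ< _)
      where
      y≡ : n ∸ x ≡ y
      y≡ = trans (cong (_∸ x) (sym (ℕ.≤-antisym (ℕ.≤-pred (recompute (_ ℕ.<? _) h)) (ℕ.≮⇒≥ x+y≮n))))
                 (ℕ.m+n∸m≡n x y)
      eq : ∀ {z} .{h′ : z + (n ∸ z) < suc n} → z ≡ x → position z (n ∸ z) h′ ≡ position x y h
      eq refl = position-≡ y≡

  positions : ∀ n → Position n ↔ Fin (#positions n)
  positions zero    = mk↔ₛ′ (λ ()) (λ ()) (λ ()) (λ ())
  positions (suc n) = ↔-trans split (↔-trans (positions n ⊎-↔ ↔-refl) (↔-sym +↔⊎))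

  sides↔ : Side ↔ Fin 3
  sides↔ = mk↔ₛ′
    (λ { left → 0F ; right → 1F ; bottom → 2F })
    (λ { 0F → left ; 1F → right ; 2F → bottom })
    (λ { 0F → refl ; 1F → refl ; 2F → refl })
    (λ { left → refl ; right → refl ; bottom → refl })

  intervals : ∀ {n} .{0<n : 0 < n} → Interval (triangle n 0<n) ↔ (Position n × Side)
  intervals {n} {0<n} = mk↔ₛ′
    (λ { (interval (s , x , y) h) → position x y (bound s h) , s })
    (λ { (position x y h , s) → intervalOf s x y h })
    (λ _ → refl) (λ _ → refl)
    where
    top≤ : ∀ {x y} → (x , suc y) ∈ˢ triangle n 0<n → x + y < n
    top≤ {x} {y} h = ℕ.≤-trans (ℕ.≤-reflexive (sym (ℕ.+-suc x y)))
      (ℕ.≤-trans (_∈ˢ_.x+y≤ h) (ℕ.≤-reflexive (ℕ.+-identityʳ n)))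
    bound : ∀ s {x y} → All (_∈ˢ triangle n 0<n) (ends (s , x , y)) → x + y < n
    bound left   (_ ∷ h ∷ []) = top≤ h
    bound right  (_ ∷ h ∷ []) = top≤ h
    bound bottom (_ ∷ h ∷ []) = ℕ.≤-trans (_∈ˢ_.x+y≤ h) (ℕ.≤-reflexive (ℕ.+-identityʳ n))

  #positions-2 : ∀ n → #positions n * 2 ≡ n * (n + 1)
  #positions-2 zero    = refl
  #positions-2 (suc n) = trans (ℕ.*-distribʳ-+ 2 (#positions n) (suc n))
    (trans (cong (_+ suc n * 2) (#positions-2 n)) (lemma n))
    where
    lemma : ∀ n → n * (n + 1) + suc n * 2 ≡ suc n * (suc n + 1)
    lemma = solve-∀

  count : ∀ n → #positions n * 3 ≡ #intervals n
  count n = trans (sym (m*n/n≡m (#positions n * 3) 2)) (cong (_/ 2)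
    (trans (lemma₁ (#positions n)) (trans (cong (3 *_) (#positions-2 n)) (lemma₂ n))))
    where
    lemma₁ : ∀ p → p * 3 * 2 ≡ 3 * (p * 2)
    lemma₁ = solve-∀
    lemma₂ : ∀ n → 3 * (n * (n + 1)) ≡ 3 * n * (n + 1)
    lemma₂ = solve-∀

numberingsExist : ∀ n .(0<n : 0 < n) → Numbering n 0<n
numberingsExist n 0<n = subst (λ N → Interval (triangle n 0<n) ↔ Fin N) (count n)
  (↔-trans intervals (↔-trans (positions n ×-↔ sides↔) (↔-sym *↔×)))

{-# OPTIONS --safe #-}

-- Both sets are identified with the valuations φ of the unit intervals by
-- 𝔽₃ for which every unit triangle becomes a piece of Ω̄ and which agree
-- with λ, μ, ν on the boundary.  As all pieces of Ω̄ are unit triangles, a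
-- tiling consists of exactly one piece per unit triangle; matching edges
-- then say that it is read off from one valuation.  A point of the variety
-- is a valuation, and it annihilates the generators precisely under the
-- conditions above: 𝓕₁ holds by Fermat, 𝓕₂ fixes the boundary, 𝓕₃ makes the
-- unit triangles atomic and 𝓕₄ then puts them into Ω̄.

module Submission where

open import Defs
open import Data.Fin.Base using (Fin; zero; suc)
open import Data.Fin.Patterns using (0F; 1F; 2F)
open import Data.Fin.Properties using (_≟_; all?)
open import Data.List.Base as List using (List; []; _∷_; _++_; filter)
open import Data.List.Membership.Propositional using () renaming (_∈_ to _∈ₗ_)
open import Data.List.Membership.Propositional.Properties using (∈-map⁺; ∈-++⁺ˡ; ∈-++⁺ʳ)
open import Data.List.Relation.Unary.All as All using (All; []; _∷_)
open import Data.List.Relation.Unary.Any using (here; there)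
open import Data.Nat.Base using (ℕ; zero; suc; _+_; _≤_; _<_; z≤n; s≤s)
import Data.Nat.Properties as ℕ
open import Data.Nat.Properties using (≤-trans)
open import Data.Product.Base using (Σ-syntax; ∃-syntax; _×_; _,_; proj₁; proj₂)
open import Data.Vec.Base as Vec using (Vec; []; _∷_; lookup; tabulate; _[_]≔_)
open import Data.Vec.Properties
  using (≡-dec; lookup-map; lookup∘tabulate; tabulate∘lookup; tabulate-cong; map-cong; map-∘)
open import Function.Base using (_∘_)
open import Function.Bundles using (Inverse; module Equivalence)
open import Level using (0ℓ)
open import Relation.Binary.Bundles using (Setoid)
open import Relation.Binary.Definitions using (DecidableEquality)
open import Relation.Binary.PropositionalEquality
open import Relation.Nullary using (yes; no; ¬?; contradiction)
open import Relation.Nullary.Decidable using (from-yes; recompute)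
open import Relation.Unary using (Pred; _∈_; _⊆_; _≐_)
open import Relation.Unary.Properties using (≐-refl; ≐-trans)

open Interval using (edge)
open Translate using (piece)
open ≡-Reasoning

-- Evaluation of polynomials

+₃-identityˡ : ∀ a → 0F +₃ a ≡ a
+₃-identityˡ = from-yes (all? λ a → 0F +₃ a ≟ a)

+₃-identityʳ : ∀ a → a +₃ 0F ≡ a
+₃-identityʳ = from-yes (all? λ a → a +₃ 0F ≟ a)

+₃-assoc : ∀ a b c → (a +₃ b) +₃ c ≡ a +₃ (b +₃ c)
+₃-assoc = from-yes (all? λ a → all? λ b → all? λ c → (a +₃ b) +₃ c ≟ a +₃ (b +₃ c))

+₃-leftComm : ∀ a b c → a +₃ (b +₃ c) ≡ b +₃ (a +₃ c)
+₃-leftComm = from-yes (all? λ a → all? λ b → all? λ c → a +₃ (b +₃ c) ≟ b +₃ (a +₃ c))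

-₃-distrib-+₃ : ∀ a b → -₃ (a +₃ b) ≡ -₃ a +₃ -₃ b
-₃-distrib-+₃ = from-yes (all? λ a → all? λ b → -₃ (a +₃ b) ≟ -₃ a +₃ -₃ b)

-₃-distribˡ-*₃ : ∀ a b → -₃ a *₃ b ≡ -₃ (a *₃ b)
-₃-distribˡ-*₃ = from-yes (all? λ a → all? λ b → -₃ a *₃ b ≟ -₃ (a *₃ b))

+₃-inverseʳ : ∀ a → a +₃ -₃ a ≡ 0F
+₃-inverseʳ = from-yes (all? λ a → a +₃ -₃ a ≟ 0F)

difference≡0⇒≡ : ∀ a b → a +₃ -₃ b ≡ 0F → a ≡ b
difference≡0⇒≡ a b a-b≡0 = begin
  a                  ≡⟨ lemma a b ⟩
  a +₃ -₃ b +₃ b     ≡⟨ cong (_+₃ b) a-b≡0 ⟩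
  0F +₃ b            ≡⟨ +₃-identityˡ b ⟩
  b                  ∎
  where
  lemma : ∀ a b → a ≡ a +₃ -₃ b +₃ b
  lemma = from-yes (all? λ a → all? λ b → a ≟ a +₃ -₃ b +₃ b)

*₃-identityˡ : ∀ a → 1F *₃ a ≡ a
*₃-identityˡ = from-yes (all? λ a → 1F *₃ a ≟ a)

*₃-identityʳ : ∀ a → a *₃ 1F ≡ a
*₃-identityʳ = from-yes (all? λ a → a *₃ 1F ≟ a)

*₃-zeroʳ : ∀ a → a *₃ 0F ≡ 0F
*₃-zeroʳ = from-yes (all? λ a → a *₃ 0F ≟ 0F)

*₃-assoc : ∀ a b c → (a *₃ b) *₃ c ≡ a *₃ (b *₃ c)
*₃-assoc = from-yes (all? λ a → all? λ b → all? λ c → (a *₃ b) *₃ c ≟ a *₃ (b *₃ c))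

*₃-distribˡ-+₃ : ∀ a b c → a *₃ (b +₃ c) ≡ a *₃ b +₃ a *₃ c
*₃-distribˡ-+₃ = from-yes (all? λ a → all? λ b → all? λ c → a *₃ (b +₃ c) ≟ a *₃ b +₃ a *₃ c)

*₃-distribʳ-+₃ : ∀ a b c → (a +₃ b) *₃ c ≡ a *₃ c +₃ b *₃ c
*₃-distribʳ-+₃ = from-yes (all? λ a → all? λ b → all? λ c → (a +₃ b) *₃ c ≟ a *₃ c +₃ b *₃ c)

*₃-interchange : ∀ a b c d → (a *₃ b) *₃ (c *₃ d) ≡ (a *₃ c) *₃ (b *₃ d)
*₃-interchange = from-yes (all? λ a → all? λ b → all? λ c → all? λ d →
  (a *₃ b) *₃ (c *₃ d) ≟ (a *₃ c) *₃ (b *₃ d))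

fermat₃ : ∀ a → a ^₃ 3 ≡ a
fermat₃ = from-yes (all? λ a → a ^₃ 3 ≟ a)

^₃-distribˡ-+ : ∀ a j k → a ^₃ (j + k) ≡ a ^₃ j *₃ a ^₃ k
^₃-distribˡ-+ a zero    k = sym (*₃-identityˡ _)
^₃-distribˡ-+ a (suc j) k = trans (cong (a *₃_) (^₃-distribˡ-+ a j k)) (sym (*₃-assoc a _ _))

-- A named copy of the function local to `eval`; both unfold to the same term, so facts about
-- monomials can be stated separately and then used inside `eval`.
evalMonomial : ∀ {N} → Vec (𝔽 3) N → Monomial N → 𝔽 3
evalMonomial a m = Vec.foldr′ _*₃_ 1F (Vec.zipWith _^₃_ a m)

evalMonomial-1 : ∀ {N} (a : Vec (𝔽 3) N) → evalMonomial a (Vec.replicate _ 0) ≡ 1F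
evalMonomial-1 []      = refl
evalMonomial-1 (x ∷ a) = trans (*₃-identityˡ _) (evalMonomial-1 a)

evalMonomial-var : ∀ {N} (a : Vec (𝔽 3) N) i → evalMonomial a (Vec.replicate _ 0 [ i ]≔ 1) ≡ lookup a i
evalMonomial-var (x ∷ a) zero    =
  trans (cong (x *₃ 1F *₃_) (evalMonomial-1 a)) (trans (*₃-identityʳ _) (*₃-identityʳ x))
evalMonomial-var (x ∷ a) (suc i) = trans (*₃-identityˡ _) (evalMonomial-var a i)

evalMonomial-* : ∀ {N} (a : Vec (𝔽 3) N) m k →
  evalMonomial a (Vec.zipWith _+_ m k) ≡ evalMonomial a m *₃ evalMonomial a k
evalMonomial-* []      []      []      = refl
evalMonomial-* (x ∷ a) (i ∷ m) (j ∷ k) =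
  trans (cong₂ _*₃_ (^₃-distribˡ-+ x i j) (evalMonomial-* a m k))
        (*₃-interchange (x ^₃ i) (x ^₃ j) _ _)

module _ {N} (a : Vec (𝔽 3) N) where

  eval-con : ∀ c → eval (con c) a ≡ c
  eval-con c = trans (+₃-identityʳ _) (trans (cong (c *₃_) (evalMonomial-1 a)) (*₃-identityʳ c))

  eval-var : ∀ i → eval (var i) a ≡ lookup a i
  eval-var i = trans (+₃-identityʳ _) (trans (*₃-identityˡ _) (evalMonomial-var a i))

  eval-+ : ∀ f g → eval (f +ᴾ g) a ≡ eval f a +₃ eval g a
  eval-+ []            g = sym (+₃-identityˡ _)
  eval-+ ((c , m) ∷ f) g =
    trans (cong (c *₃ evalMonomial a m +₃_) (eval-+ f g)) (sym (+₃-assoc (c *₃ evalMonomial a m) _ _))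

  eval-neg : ∀ g → eval (List.map (λ (c , m) → -₃ c , m) g) a ≡ -₃ eval g a
  eval-neg []            = refl
  eval-neg ((c , m) ∷ g) =
    trans (cong₂ _+₃_ (-₃-distribˡ-*₃ c _) (eval-neg g)) (sym (-₃-distrib-+₃ (c *₃ evalMonomial a m) _))

  eval-- : ∀ f g → eval (f -ᴾ g) a ≡ eval f a +₃ -₃ eval g a
  eval-- f g = trans (eval-+ f _) (cong (eval f a +₃_) (eval-neg g))

  eval-* : ∀ f g → eval (f *ᴾ g) a ≡ eval f a *₃ eval g a
  eval-* []            g = refl
  eval-* ((c , m) ∷ f) g = begin
    eval (term* g ++ f *ᴾ g) a                         ≡⟨ eval-+ (term* g) (f *ᴾ g) ⟩
    eval (term* g) a +₃ eval (f *ᴾ g) a                ≡⟨ cong₂ _+₃_ (eval-term* g) (eval-* f g) ⟩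
    c *₃ M *₃ eval g a +₃ eval f a *₃ eval g a         ≡⟨ *₃-distribʳ-+₃ (c *₃ M) _ _ ⟨
    (c *₃ M +₃ eval f a) *₃ eval g a                   ∎
    where
    M = evalMonomial a m
    -- `cartesianProductWith` first lists the products of the leading term with `g`, which is this
    -- map, and then continues with `f *ᴾ g`.
    term* : Poly N → Poly N
    term* = List.map (λ (d , k) → c *₃ d , Vec.zipWith _+_ m k)
    eval-term* : ∀ g → eval (term* g) a ≡ c *₃ M *₃ eval g a
    eval-term* []            = sym (*₃-zeroʳ (c *₃ M))
    eval-term* ((d , k) ∷ g) = begin
      c *₃ d *₃ evalMonomial a (Vec.zipWith _+_ m k) +₃ eval (term* g) a
        ≡⟨ cong₂ _+₃_ (trans (cong (c *₃ d *₃_) (evalMonomial-* a m k)) (*₃-interchange c d M _)) (eval-term* g) ⟩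
      c *₃ M *₃ (d *₃ evalMonomial a k) +₃ c *₃ M *₃ eval g a
        ≡⟨ *₃-distribˡ-+₃ (c *₃ M) _ _ ⟨
      c *₃ M *₃ (d *₃ evalMonomial a k +₃ eval g a) ∎

  eval-^ : ∀ f k → eval (f ^ᴾ k) a ≡ eval f a ^₃ k
  eval-^ f zero    = eval-con 1F
  eval-^ f (suc k) = trans (eval-* f (f ^ᴾ k)) (cong (eval f a *₃_) (eval-^ f k))

  eval-substitute : ∀ {M} f (gs : Vec (Poly N) M) →
    eval (substitute f gs) a ≡ eval f (Vec.map (λ g → eval g a) gs)
  eval-substitute []            gs = eval-con 0F
  eval-substitute ((c , m) ∷ f) gs =
    trans (eval-+ (con c *ᴾ m[gs]) _) (cong₂ _+₃_
      (trans (eval-* (con c) m[gs]) (cong₂ _*₃_ (eval-con c) (eval-substMonomial gs m)))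
      (eval-substitute f gs))
    where
    m[gs] = Vec.foldr′ _*ᴾ_ (con 1F) (Vec.zipWith _^ᴾ_ gs m)
    eval-substMonomial : ∀ {M} (gs : Vec (Poly N) M) m →
      eval (Vec.foldr′ _*ᴾ_ (con 1F) (Vec.zipWith _^ᴾ_ gs m)) a ≡
      evalMonomial (Vec.map (λ g → eval g a) gs) m
    eval-substMonomial []       []      = eval-con 1F
    eval-substMonomial (g ∷ gs) (j ∷ m) =
      trans (eval-* (g ^ᴾ j) _) (cong₂ _*₃_ (eval-^ g j) (eval-substMonomial gs m))

-- Evaluation depends only on the coefficients

_≟ᵐ_ : ∀ {N} → DecidableEquality (Monomial N)
_≟ᵐ_ = ≡-dec ℕ._≟_

-- Since `_≈ᴾ_` ignores order and repetition of terms, related lists cannot be compared term by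
-- term. Deleting every term with one monomial at once respects `_≈ᴾ_` and can be iterated.
remove : ∀ {N} → Monomial N → Poly N → Poly N
remove k = filter (λ (_ , m) → ¬? (m ≟ᵐ k))

coeff-remove-≡ : ∀ {N} k (f : Poly N) → coeff (remove k f) k ≡ 0F
coeff-remove-≡ k []            = refl
coeff-remove-≡ k ((c , m) ∷ f) with m ≟ᵐ k in eq
... | yes _ = coeff-remove-≡ k f
-- The term is kept, and `coeff` now repeats the test already made by `filter`.
... | no  _ rewrite eq = coeff-remove-≡ k f

coeff-remove-≢ : ∀ {N} k {m} → k ≢ m → (f : Poly N) → coeff (remove k f) m ≡ coeff f m
coeff-remove-≢ k k≢m []            = refl
coeff-remove-≢ k {m} k≢m ((c , m′) ∷ f) with m′ ≟ᵐ k
... | yes refl with m′ ≟ᵐ m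
...   | yes k≡m = contradiction k≡m k≢m
...   | no  _   = coeff-remove-≢ k k≢m f
coeff-remove-≢ k {m} k≢m ((c , m′) ∷ f) | no _ with m′ ≟ᵐ m
... | yes _ = cong (c +₃_) (coeff-remove-≢ k k≢m f)
... | no  _ = coeff-remove-≢ k k≢m f

remove-cong : ∀ {N} k {f g : Poly N} → f ≈ᴾ g → remove k f ≈ᴾ remove k g
remove-cong k {f} {g} f≈g m with k ≟ᵐ m
... | yes refl = trans (coeff-remove-≡ k f) (sym (coeff-remove-≡ k g))
... | no  k≢m  = trans (coeff-remove-≢ k k≢m f) (trans (f≈g m) (sym (coeff-remove-≢ k k≢m g)))

SupportedBy : ∀ {N} → List (Monomial N) → Poly N → Set
SupportedBy ms = All (λ (_ , m) → m ∈ₗ ms)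

remove-supported : ∀ {N k ms} {f : Poly N} → SupportedBy (k ∷ ms) f → SupportedBy ms (remove k f)
remove-supported []                                = []
remove-supported {k = k} {f = (_ , m) ∷ _} (p ∷ ps) with m ≟ᵐ k
... | yes _   = remove-supported ps
... | no  m≢k with p
...   | here m≡k   = contradiction m≡k m≢k
...   | there m∈ms = m∈ms ∷ remove-supported ps

module _ {N} (a : Vec (𝔽 3) N) where

  -- By distributivity the deleted terms contribute a quantity that depends on `f` only through one
  -- coefficient, so it is the same for polynomials related by `_≈ᴾ_`.
  eval-remove : ∀ k f → eval f a ≡ coeff f k *₃ evalMonomial a k +₃ eval (remove k f) a
  eval-remove k []            = refl
  eval-remove k ((c , m) ∷ f) with m ≟ᵐ k
  ... | no  _    = trans (cong (c *₃ evalMonomial a m +₃_) (eval-remove k f))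
                         (+₃-leftComm (c *₃ evalMonomial a m) (coeff f k *₃ evalMonomial a k) _)
  ... | yes refl = begin
    c *₃ M +₃ eval f a                                 ≡⟨ cong (c *₃ M +₃_) (eval-remove k f) ⟩
    c *₃ M +₃ (coeff f k *₃ M +₃ eval (remove k f) a)  ≡⟨ +₃-assoc (c *₃ M) _ _ ⟨
    c *₃ M +₃ coeff f k *₃ M +₃ eval (remove k f) a    ≡⟨ cong (_+₃ eval (remove k f) a) (*₃-distribʳ-+₃ c (coeff f k) M) ⟨
    (c +₃ coeff f k) *₃ M +₃ eval (remove k f) a       ∎
    where M = evalMonomial a k

  -- Induction on ms, splitting off all terms with the first monomial of ms.
  eval-cong-supported : ∀ ms {f g} → SupportedBy ms f → SupportedBy ms g → f ≈ᴾ g → eval f a ≡ eval g a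
  eval-cong-supported []       []       []       f≈g = refl
  eval-cong-supported []       (() ∷ _) _        f≈g
  eval-cong-supported []       []       (() ∷ _) f≈g
  eval-cong-supported (k ∷ ms) {f} {g} fs gs f≈g = begin
    eval f a                                              ≡⟨ eval-remove k f ⟩
    coeff f k *₃ evalMonomial a k +₃ eval (remove k f) a  ≡⟨ cong₂ _+₃_ (cong (_*₃ _) (f≈g k))
      (eval-cong-supported ms (remove-supported fs) (remove-supported gs) (remove-cong k {f} {g} f≈g)) ⟩
    coeff g k *₃ evalMonomial a k +₃ eval (remove k g) a  ≡⟨ eval-remove k g ⟨
    eval g a                                              ∎

  eval-cong : ∀ f g → f ≈ᴾ g → eval f a ≡ eval g a
  -- Repetitions in this list are harmless: once removed, a monomial has coefficient 0.
  eval-cong f g = eval-cong-supported (List.map proj₂ f ++ List.map proj₂ g)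
    (All.tabulate {xs = f} (∈-++⁺ˡ ∘ ∈-map⁺ proj₂))
    (All.tabulate {xs = g} (∈-++⁺ʳ (List.map proj₂ f) ∘ ∈-map⁺ proj₂))

  -- Induction on how the element is generated. The case `respᴵ` is where `eval` has to be well
  -- defined up to `_≈ᴾ_`.
  ideal-vanishes : {G : Pred (Poly N) 0ℓ} → (∀ {g} → g ∈ G → eval g a ≡ 0F) →
                   ∀ {f} → f ∈ Ideal G → eval f a ≡ 0F
  ideal-vanishes z (generator g∈G)      = z g∈G
  ideal-vanishes z zeroᴵ                = eval-con a 0F
  ideal-vanishes z (sumᴵ {f} {g} p q)   =
    trans (eval-+ a f g) (cong₂ _+₃_ (ideal-vanishes z p) (ideal-vanishes z q))
  ideal-vanishes z (multipleᴵ h {f} p)  =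
    trans (eval-* a h f) (trans (cong (eval h a *₃_) (ideal-vanishes z p)) (*₃-zeroʳ (eval h a)))
  ideal-vanishes z (respᴵ {f} {g} f≈g p) = trans (sym (eval-cong f g f≈g)) (ideal-vanishes z p)

-- Tilings as valuations of the unit intervals

-- The three values come in the order of `sides`. In standard position a unit triangle occupies the
-- cell `up (0 , 0)` or `down (0 , 0)`, so the point of the cell serves as translation vector.
tileAt : Cell → Vec (𝔽 3) 3 → Translate 3
tileAt (up   w) (l ∷ r ∷ b ∷ []) = upTri l r b at w
tileAt (down w) (l ∷ t ∷ r ∷ []) = downTri l t r at w

+ᵖ-identityʳ : ∀ w → w +ᵖ (0 , 0) ≡ w
+ᵖ-identityʳ (a , b) = cong₂ _,_ (ℕ.+-identityʳ a) (ℕ.+-identityʳ b)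

+ᵖ-e₁ : ∀ a b → (a , b) +ᵖ (1 , 0) ≡ (suc a , b)
+ᵖ-e₁ a b = cong₂ _,_ (ℕ.+-comm a 1) (ℕ.+-identityʳ b)

+ᵖ-e₂ : ∀ a b → (a , b) +ᵖ (0 , 1) ≡ (a , suc b)
+ᵖ-e₂ a b = cong₂ _,_ (ℕ.+-identityʳ a) (ℕ.+-comm b 1)

tileAt-covers : ∀ u v → tileAt u v covers u
tileAt-covers (up w) (l ∷ r ∷ b ∷ []) =
  up (0 , 0) ,
  (inPolygon z≤n z≤n z≤n z≤n ∷ inPolygon 1≤1 z≤n z≤n 1≤1 ∷ inPolygon z≤n 1≤1 z≤n 1≤1 ∷ []) ,
  cong up (sym (+ᵖ-identityʳ w))
  where 1≤1 = ℕ.≤-refl {1}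
tileAt-covers (down w) (l ∷ t ∷ r ∷ []) =
  down (0 , 0) ,
  (inPolygon 1≤1 z≤n 1≤1 1≤2 ∷ inPolygon z≤n 1≤1 1≤1 1≤2 ∷ inPolygon 1≤1 1≤1 1≤2 ℕ.≤-refl ∷ []) ,
  cong down (sym (+ᵖ-identityʳ w))
  where
  1≤1 = ℕ.≤-refl {1}
  1≤2 = ℕ.n≤1+n 1

-- For a cell of the same orientation, the corners `(suc x , y)` and `(x , suc y)` force `x` and `y`
-- to be 0. A cell of the opposite orientation violates an inequality of the polygon: `down` has the
-- corner (1 , 1) or one even further out, while `up` at the origin has the corner (0 , 0), which
-- the lower left side cuts off.
covers-tileAt : ∀ u v {u′} → tileAt u v covers u′ → u′ ≡ u
covers-tileAt (up w) (l ∷ r ∷ b ∷ [])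
  (up (.0 , .0) , _ ∷ inPolygon (s≤s z≤n) _ _ _ ∷ inPolygon _ (s≤s z≤n) _ _ ∷ [] , refl) =
  cong up (+ᵖ-identityʳ w)
covers-tileAt (up w) (l ∷ r ∷ b ∷ [])
  (down (zero , zero) , _ ∷ _ ∷ inPolygon _ _ _ (s≤s ()) ∷ [] , refl)
covers-tileAt (up w) (l ∷ r ∷ b ∷ [])
  (down (zero , suc y) , _ ∷ _ ∷ inPolygon _ (s≤s ()) _ _ ∷ [] , refl)
covers-tileAt (up w) (l ∷ r ∷ b ∷ [])
  (down (suc x , y) , inPolygon (s≤s ()) _ _ _ ∷ _ ∷ _ ∷ [] , refl)
covers-tileAt (down w) (l ∷ t ∷ r ∷ [])
  (down (.0 , .0) , inPolygon (s≤s z≤n) _ _ _ ∷ inPolygon _ (s≤s z≤n) _ _ ∷ _ ∷ [] , refl) =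
  cong down (+ᵖ-identityʳ w)
covers-tileAt (down w) (l ∷ t ∷ r ∷ [])
  (up (.0 , .0) , inPolygon _ _ () _ ∷ inPolygon (s≤s z≤n) _ _ _ ∷ inPolygon _ (s≤s z≤n) _ _ ∷ [] , refl)

module _ {s : Shape} where

  -- The field `inside` is irrelevant, so `edge` is all the data there is.
  edge-injective : {i j : Interval s} → edge i ≡ edge j → i ≡ j
  edge-injective refl = refl

  -- Edges are named after the upward triangle they bound. The top side of a `down` cell belongs to
  -- the upward triangle one step along e₂, its right side to the one along e₁; hence the shifts in
  -- the last two cases.
  tileAt-boundary⁺ : ∀ u .(u∈s : u ∈ᶜ s) v i →
    HasBoundaryValue (tileAt u v) (edge (lookup (sides u u∈s) i)) (lookup v i)
  tileAt-boundary⁺ (up w) _ (l ∷ r ∷ b ∷ []) 0F = _ , upLB 0F , cong (left ,_) (sym (+ᵖ-identityʳ w))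
  tileAt-boundary⁺ (up w) _ (l ∷ r ∷ b ∷ []) 1F = _ , upRB 0F , cong (right ,_) (sym (+ᵖ-identityʳ w))
  tileAt-boundary⁺ (up w) _ (l ∷ r ∷ b ∷ []) 2F = _ , botB 0F , cong (bottom ,_) (sym (+ᵖ-identityʳ w))
  tileAt-boundary⁺ (down w) _ (l ∷ t ∷ r ∷ []) 0F = _ , loLB 0F , cong (right ,_) (sym (+ᵖ-identityʳ w))
  tileAt-boundary⁺ (down (a , b)) _ (l ∷ t ∷ r ∷ []) 1F = _ , topB 0F , cong (bottom ,_) (sym (+ᵖ-e₂ a b))
  tileAt-boundary⁺ (down (a , b)) _ (l ∷ t ∷ r ∷ []) 2F = _ , loRB 0F , cong (left ,_) (sym (+ᵖ-e₁ a b))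

  tileAt-boundary⁻ : ∀ u .(u∈s : u ∈ᶜ s) v {e c} → HasBoundaryValue (tileAt u v) e c →
    ∃[ i ] e ≡ edge (lookup (sides u u∈s) i) × c ≡ lookup v i
  tileAt-boundary⁻ (up w) _ (l ∷ r ∷ b ∷ []) (_ , upLB 0F , refl) = 0F , cong (left ,_) (+ᵖ-identityʳ w) , refl
  tileAt-boundary⁻ (up w) _ (l ∷ r ∷ b ∷ []) (_ , upRB 0F , refl) = 1F , cong (right ,_) (+ᵖ-identityʳ w) , refl
  tileAt-boundary⁻ (up w) _ (l ∷ r ∷ b ∷ []) (_ , botB 0F , refl) = 2F , cong (bottom ,_) (+ᵖ-identityʳ w) , refl
  tileAt-boundary⁻ (down w) _ (l ∷ t ∷ r ∷ []) (_ , loLB 0F , refl) = 0F , cong (right ,_) (+ᵖ-identityʳ w) , refl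
  tileAt-boundary⁻ (down (a , b)) _ (l ∷ t ∷ r ∷ []) (_ , topB 0F , refl) = 1F , cong (bottom ,_) (+ᵖ-e₂ a b) , refl
  tileAt-boundary⁻ (down (a , b)) _ (l ∷ t ∷ r ∷ []) (_ , loRB 0F , refl) = 2F , cong (left ,_) (+ᵖ-e₁ a b) , refl

atomic⇒tileAt : ∀ {p} → Atomic p → ∀ w → ∃[ u ] ∃[ v ] p at w ≡ tileAt u v
atomic⇒tileAt (upAtomic   _) w = up w , _ ∷ _ ∷ _ ∷ [] , refl
atomic⇒tileAt (downAtomic _) w = down w , _ ∷ _ ∷ _ ∷ [] , refl

atomic-up-sum : ∀ {l r b} → Atomic (upTri l r b) → l +₃ r +₃ b ≡ 0F
atomic-up-sum (upAtomic eq) = eq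

atomic-down-sum : ∀ {l t r} → Atomic (downTri l t r) → l +₃ t +₃ r ≡ 0F
atomic-down-sum (downAtomic eq) = eq

lookup-ext : ∀ {A : Set} {n} {v w : Vec A n} → (∀ i → lookup v i ≡ lookup w i) → v ≡ w
lookup-ext {v = v} {w} eq = trans (sym (tabulate∘lookup v)) (trans (tabulate-cong eq) (tabulate∘lookup w))

-- Fillings of the big triangle and their tilings

module _ {n} .{0<n : 0 < n} where

  private
    △ₙ : Shape
    △ₙ = triangle n 0<n

  -- A canonical cell from which the value on an interval can be read. The upward triangle is chosen
  -- because it always lies in the big triangle, whereas the downward neighbour of a boundary
  -- interval lies outside.
  owner : Interval △ₙ → Cell
  owner e = up (proj₂ (edge e))

  ownerSide : Interval △ₙ → Fin 3
  ownerSide (interval (left   , _) _) = 0F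
  ownerSide (interval (right  , _) _) = 1F
  ownerSide (interval (bottom , _) _) = 2F

  owner∈△ : ∀ e → owner e ∈ᶜ △ₙ
  owner∈△ (interval (s , x , y) e∈△) = ∈triangle (ℕ.<⇒≤ x+y<n) ∷ ∈triangle x+y<n ∷ ∈triangle (x+1+y≤n x+y<n) ∷ []
    where
    x+1+y≤n : x + y < n → x + suc y ≤ n
    x+1+y≤n = ℕ.≤-trans (ℕ.≤-reflexive (ℕ.+-suc x y))
    bound : ∀ {P} → P ∈ˢ △ₙ → proj₁ P + proj₂ P ≤ n
    bound h = ℕ.≤-trans (_∈ˢ_.x+y≤ h) (ℕ.≤-reflexive (ℕ.+-identityʳ n))
    ends⇒x+y<n : ∀ s → All (_∈ˢ △ₙ) (ends (s , x , y)) → x + y < n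
    ends⇒x+y<n left   (_ ∷ h ∷ []) = ℕ.≤-trans (ℕ.≤-reflexive (sym (ℕ.+-suc x y))) (bound h)
    ends⇒x+y<n right  (h ∷ _ ∷ []) = bound h
    ends⇒x+y<n bottom (_ ∷ h ∷ []) = bound h
    x+y<n : x + y < n
    -- `e∈△` is irrelevant; the inequality is recovered because it is decidable.
    x+y<n = recompute (x + y ℕ.<? n) (ends⇒x+y<n s e∈△)

  lookup-ownerSide : ∀ e → lookup (sides (owner e) (owner∈△ e)) (ownerSide e) ≡ e
  lookup-ownerSide (interval (left   , _) _) = refl
  lookup-ownerSide (interval (right  , _) _) = refl
  lookup-ownerSide (interval (bottom , _) _) = refl

  module _ (l r b : Vec (𝔽 3) n) (Π : Pred (Piece 3) 0ℓ) where

    cellTile : (Interval △ₙ → 𝔽 3) → ∀ u → .(u ∈ᶜ △ₙ) → Translate 3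
    cellTile φ u u∈△ = tileAt u (Vec.map φ (sides u u∈△))

    -- Matching along common edges is built in, as `φ` gives each interval a single value.
    record Filling (φ : Interval △ₙ → 𝔽 3) : Set where
      field
        allowed  : ∀ u (u∈△ : u ∈ᶜ △ₙ) → piece (cellTile φ u u∈△) ∈ Π
        onLeft   : ∀ j → φ (leftInterval j) ≡ lookup l j
        onRight  : ∀ j → φ (rightInterval j) ≡ lookup r j
        onBottom : ∀ j → φ (bottomInterval j) ≡ lookup b j

    tilesOf : (Interval △ₙ → 𝔽 3) → Pred (Translate 3) 0ℓ
    tilesOf φ t = ∃[ u ] Σ[ u∈△ ∈ u ∈ᶜ △ₙ ] t ≡ cellTile φ u u∈△

    cellTile-cong : ∀ {φ ψ} → φ ≗ ψ → ∀ u .(u∈△ : u ∈ᶜ △ₙ) → cellTile φ u u∈△ ≡ cellTile ψ u u∈△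
    cellTile-cong φ≗ψ u u∈△ = cong (tileAt u) (map-cong φ≗ψ (sides u u∈△))

    tilesOf-cong : ∀ {φ ψ} → φ ≗ ψ → tilesOf φ ≐ tilesOf ψ
    tilesOf-cong φ≗ψ =
      (λ { (u , u∈△ , t≡) → u , u∈△ , trans t≡ (cellTile-cong φ≗ψ u u∈△) }) ,
      (λ { (u , u∈△ , t≡) → u , u∈△ , trans t≡ (sym (cellTile-cong φ≗ψ u u∈△)) })

    filling-cong : ∀ {φ ψ} → φ ≗ ψ → Filling φ → Filling ψ
    filling-cong φ≗ψ F = record
      { allowed  = λ u u∈△ → subst (λ t → piece t ∈ Π) (cellTile-cong φ≗ψ u u∈△) (F.allowed u u∈△)
      ; onLeft   = λ j → trans (sym (φ≗ψ (leftInterval j))) (F.onLeft j)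
      ; onRight  = λ j → trans (sym (φ≗ψ (rightInterval j))) (F.onRight j)
      ; onBottom = λ j → trans (sym (φ≗ψ (bottomInterval j))) (F.onBottom j)
      }
      where module F = Filling F

    tilesOf-boundary : ∀ {φ t e c} → t ∈ tilesOf φ → HasBoundaryValue t e c →
                       ∃[ i ] e ≡ edge i × c ≡ φ i
    tilesOf-boundary {φ} (u , u∈△ , refl) t∋e with tileAt-boundary⁻ u u∈△ _ t∋e
    ... | i , e≡ , c≡ = lookup (sides u u∈△) i , e≡ , trans c≡ (lookup-map i φ (sides u u∈△))

    tilesOf-value : ∀ {φ t c} i → t ∈ tilesOf φ → HasBoundaryValue t (edge i) c → c ≡ φ i
    tilesOf-value {φ} i t∈ t∋e with tilesOf-boundary t∈ t∋e
    ... | j , e≡ , c≡ = trans c≡ (cong φ (sym (edge-injective {i = i} {j} e≡)))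

    toTiling : ∀ φ → Filling φ → Tiling (△ 0<n l r b) Π
    toTiling φ F = record
      { tiles         = tilesOf φ
      ; allowed       = λ { (u , u∈△ , refl) → F.allowed u u∈△ }
      ; inside        = λ { (u , u∈△ , refl) t∋u → subst (_∈ᶜ △ₙ) (sym (covers-tileAt u _ t∋u)) u∈△ }
      ; noGaps        = λ {u} u∈△ → _ , (u , u∈△ , refl) , tileAt-covers u _
      ; noOverlaps    = λ { (u , u∈△ , refl) (u′ , u′∈△ , refl) t∋ t′∋ →
                            unique (trans (sym (covers-tileAt u _ t∋)) (covers-tileAt u′ _ t′∋)) }
      ; edgesMatch    = edgesMatch
      ; boundaryMatch = boundaryMatch
      }
      where
      module F = Filling F
      -- The membership proofs are irrelevant, so equal cells carry the same tile.
      unique : ∀ {u u′} .{h : u ∈ᶜ △ₙ} .{h′ : u′ ∈ᶜ △ₙ} → u ≡ u′ → cellTile φ u h ≡ cellTile φ u′ h′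
      unique refl = refl
      edgesMatch : ∀ {t t′ e c c′} → t ∈ tilesOf φ → t′ ∈ tilesOf φ →
                   HasBoundaryValue t e c → HasBoundaryValue t′ e c′ → c ≡ c′
      edgesMatch t∈ t′∈ t∋e t′∋e with tilesOf-boundary t∈ t∋e
      ... | i , refl , c≡ = trans c≡ (sym (tilesOf-value i t′∈ t′∋e))
      boundaryMatch : ∀ {t e c c′} → t ∈ tilesOf φ →
                      BoundaryValue (△ 0<n l r b) e c → HasBoundaryValue t e c′ → c ≡ c′
      -- The other three sides of the shape have length 0, and the edges named by these constructors
      -- are definitionally those of `bottomInterval`, `leftInterval` and `rightInterval`.
      boundaryMatch t∈ (botB j) t∋e = sym (trans (tilesOf-value (bottomInterval j) t∈ t∋e) (F.onBottom j))
      boundaryMatch t∈ (upLB j) t∋e = sym (trans (tilesOf-value (leftInterval j) t∈ t∋e) (F.onLeft j))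
      boundaryMatch t∈ (upRB j) t∋e = sym (trans (tilesOf-value (rightInterval j) t∈ t∋e) (F.onRight j))

    -- The valuation of a tiling

    module _ (Π⊆Atomic : Π ⊆ Atomic) (T : Tiling (△ 0<n l r b) Π) where

      open Tiling T

      -- The tile covering `u` is a unit triangle, and a unit triangle covers only its own cell, so
      -- it sits at `u`.
      cellValues : ∀ u → u ∈ᶜ △ₙ → ∃[ v ] tileAt u v ∈ tiles
      cellValues u u∈△ with noGaps u∈△
      ... | (p at w) , t∈T , t∋u with atomic⇒tileAt (Π⊆Atomic (allowed t∈T)) w
      ...   | u′ , v , refl = v , subst (λ u → tileAt u v ∈ tiles) (sym (covers-tileAt u′ v t∋u)) t∈T

      valuation : Interval △ₙ → 𝔽 3
      valuation e = lookup (proj₁ (cellValues (owner e) (owner∈△ e))) (ownerSide e)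

      valuation-attained : ∀ e → ∃[ t ] t ∈ tiles × HasBoundaryValue t (edge e) (valuation e)
      valuation-attained e =
        let v , t∈T = cellValues (owner e) (owner∈△ e) in
        tileAt (owner e) v , t∈T ,
        subst (λ e′ → HasBoundaryValue (tileAt (owner e) v) (edge e′) (valuation e)) (lookup-ownerSide e)
          (tileAt-boundary⁺ (owner e) (owner∈△ e) v (ownerSide e))

      -- The value was read from the owner's tile; by edge matching every other tile bordering `e`
      -- gives the same one.
      valuation-unique : ∀ {t c} e → t ∈ tiles → HasBoundaryValue t (edge e) c → valuation e ≡ c
      valuation-unique e t∈T t∋e =
        let t′ , t′∈T , t′∋e = valuation-attained e in edgesMatch t′∈T t∈T t′∋e t∋e

      valuation-sides : ∀ u .(u∈△ : u ∈ᶜ △ₙ) {v} → tileAt u v ∈ tiles →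
                        Vec.map valuation (sides u u∈△) ≡ v
      valuation-sides u u∈△ {v} t∈T = lookup-ext λ i → trans (lookup-map i valuation (sides u u∈△))
        (valuation-unique (lookup (sides u u∈△) i) t∈T (tileAt-boundary⁺ u u∈△ v i))

      -- A tile at `u` is determined by its three values, and these are the values of `valuation` on
      -- the sides of `u`. `noGaps` supplies a tile for each cell, and `inside` keeps every tile
      -- within the big triangle.
      tilesOf-valuation : tilesOf valuation ≐ tiles
      tilesOf-valuation = tilesOf⊆tiles , tiles⊆tilesOf
        where
        tilesOf⊆tiles : tilesOf valuation ⊆ tiles
        tilesOf⊆tiles (u , u∈△ , refl) with cellValues u u∈△
        ... | v , t∈T = subst (λ v → tileAt u v ∈ tiles) (sym (valuation-sides u u∈△ t∈T)) t∈T
        tiles⊆tilesOf : tiles ⊆ tilesOf valuation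
        tiles⊆tilesOf {p at w} t∈T with atomic⇒tileAt (Π⊆Atomic (allowed t∈T)) w
        ... | u , v , refl = let u∈△ = inside t∈T (tileAt-covers u v) in
          u , u∈△ , cong (tileAt u) (sym (valuation-sides u u∈△ t∈T))

      valuation-filling : Filling valuation
      valuation-filling = record
        { allowed  = λ u u∈△ → allowed (proj₁ tilesOf-valuation (u , u∈△ , refl))
        ; onLeft   = λ j → onBoundary (leftInterval j) (upLB j)
        ; onRight  = λ j → onBoundary (rightInterval j) (upRB j)
        ; onBottom = λ j → onBoundary (bottomInterval j) (botB j)
        }
        where
        onBoundary : ∀ e {c} → BoundaryValue (△ 0<n l r b) (edge e) c → valuation e ≡ c
        onBoundary e e∈∂ =
          let t , t∈T , t∋e = valuation-attained e in sym (boundaryMatch t∈T e∈∂ t∋e)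

-- Points of the variety as tilings

module _ {n} .{0<n : 0 < n} (numbering : Numbering n 0<n)
         (la mu nu : Vec (𝔽 2) n) (Π : Pred (Piece 3) 0ℓ) (Π⊆Atomic : Π ⊆ Atomic)
         (f↑ f↓ : Poly 3) (up-dist : UpDistinguishing Π f↑) (down-dist : DownDistinguishing Π f↓) where

  private
    I : Pred (Poly (#intervals n)) 0ℓ
    I = atomicPuzzleIdeal numbering la mu nu f↑ f↓

    l r b : Vec (𝔽 3) n
    l = Vec.map embed la
    r = Vec.map embed mu
    b = Vec.map embed nu

    module # = Inverse numbering

    x : Interval (triangle n 0<n) → Poly (#intervals n)
    x e = var (#.to e)

  pointValuation : Vec (𝔽 3) (#intervals n) → Interval (triangle n 0<n) → 𝔽 3
  pointValuation a e = lookup a (#.to e)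

  module _ (a : Vec (𝔽 3) (#intervals n)) where

    private
      φ = pointValuation a

    eval-x-con : ∀ e c → eval (x e -ᴾ con c) a ≡ φ e +₃ -₃ c
    eval-x-con e c = trans (eval-- a (x e) (con c))
      (cong₂ (λ y z → y +₃ -₃ z) (eval-var a (#.to e)) (eval-con a c))

    -- The fold brackets to the right and ends in `con 0F`, whereas `Atomic` brackets to the left.
    eval-sum-x : ∀ e₁ e₂ e₃ →
      eval (Vec.foldr′ _+ᴾ_ (con 0F) (x e₁ ∷ x e₂ ∷ x e₃ ∷ [])) a ≡ φ e₁ +₃ φ e₂ +₃ φ e₃
    eval-sum-x e₁ e₂ e₃ =
      trans (eval-+ a (x e₁) (x e₂ +ᴾ (x e₃ +ᴾ con 0F)))
      (trans (cong₂ _+₃_ (eval-var a (#.to e₁))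
        (trans (eval-+ a (x e₂) (x e₃ +ᴾ con 0F)) (cong₂ _+₃_ (eval-var a (#.to e₂))
          (trans (eval-+ a (x e₃) (con 0F)) (trans (cong₂ _+₃_ (eval-var a (#.to e₃)) (eval-con a 0F))
            (+₃-identityʳ (φ e₃)))))))
      (sym (+₃-assoc (φ e₁) (φ e₂) (φ e₃))))

    eval-substitute-x : ∀ f (es : Vec (Interval (triangle n 0<n)) 3) →
      eval (substitute f (Vec.map x es)) a ≡ eval f (Vec.map φ es)
    eval-substitute-x f es = trans (eval-substitute a f (Vec.map x es)) (cong (eval f)
      (trans (sym (map-∘ _ x es)) (map-cong (λ e → eval-var a (#.to e)) es)))

    filling⇒zero : Filling l r b Π φ → ∀ {f} → f ∈ I → eval f a ≡ 0F
    filling⇒zero F = ideal-vanishes a λ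
      { (𝓕₁ i)  → trans (eval-- a (var i ^ᴾ 3) (var i)) (trans
          (cong (_+₃ -₃ eval (var i) a) (trans (eval-^ a (var i) 3) (fermat₃ (eval (var i) a))))
          (+₃-inverseʳ (eval (var i) a)))
      ; (𝓕₂ˡ j) → boundary (leftInterval j) la j (F.onLeft j)
      ; (𝓕₂ʳ j) → boundary (rightInterval j) mu j (F.onRight j)
      ; (𝓕₂ᵇ j) → boundary (bottomInterval j) nu j (F.onBottom j)
      ; (𝓕₃ (up v) u∈△) → trans (eval-sum-x _ _ _) (atomic-up-sum (Π⊆Atomic (F.allowed (up v) u∈△)))
      ; (𝓕₃ (down v) u∈△) → trans (eval-sum-x _ _ _) (atomic-down-sum (Π⊆Atomic (F.allowed (down v) u∈△)))
      ; (𝓕₄↑ v u∈△) → let p∈Π = F.allowed (up v) u∈△ in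
          trans (eval-substitute-x f↑ (sides (up v) u∈△)) (Equivalence.from (up-dist _ _ _ (Π⊆Atomic p∈Π)) p∈Π)
      ; (𝓕₄↓ v u∈△) → let p∈Π = F.allowed (down v) u∈△ in
          trans (eval-substitute-x f↓ (sides (down v) u∈△)) (Equivalence.from (down-dist _ _ _ (Π⊆Atomic p∈Π)) p∈Π)
      }
      where
      module F = Filling F
      boundary : ∀ e (c : Vec (𝔽 2) n) j → φ e ≡ lookup (Vec.map embed c) j → eval (x e -ᴾ con (embed (lookup c j))) a ≡ 0F
      boundary e c j φe≡c = trans (eval-x-con e (embed (lookup c j))) (trans
        (cong (_+₃ -₃ embed (lookup c j)) (trans φe≡c (lookup-map j embed c)))
        (+₃-inverseʳ (embed (lookup c j))))

    zero⇒filling : (∀ {f} → f ∈ I → eval f a ≡ 0F) → Filling l r b Π φ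
    zero⇒filling z = record
      -- A distinguishing polynomial decides membership for atomic pieces only, so 𝓕₃ comes first to
      -- make the triangle atomic.
      { allowed  = λ
        { (up v) u∈△ → Equivalence.to
            (up-dist _ _ _ (upAtomic (trans (sym (eval-sum-x _ _ _)) (z (generator (𝓕₃ (up v) u∈△))))))
            (trans (sym (eval-substitute-x f↑ (sides (up v) u∈△))) (z (generator (𝓕₄↑ v u∈△))))
        ; (down v) u∈△ → Equivalence.to
            (down-dist _ _ _ (downAtomic (trans (sym (eval-sum-x _ _ _)) (z (generator (𝓕₃ (down v) u∈△))))))
            (trans (sym (eval-substitute-x f↓ (sides (down v) u∈△))) (z (generator (𝓕₄↓ v u∈△))))
        }
      ; onLeft   = λ j → boundary (leftInterval j) la j (z (generator (𝓕₂ˡ j)))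
      ; onRight  = λ j → boundary (rightInterval j) mu j (z (generator (𝓕₂ʳ j)))
      ; onBottom = λ j → boundary (bottomInterval j) nu j (z (generator (𝓕₂ᵇ j)))
      }
      where
      boundary : ∀ e (c : Vec (𝔽 2) n) j → eval (x e -ᴾ con (embed (lookup c j))) a ≡ 0F → φ e ≡ lookup (Vec.map embed c) j
      boundary e c j eval≡0 = trans
        (difference≡0⇒≡ (φ e) (embed (lookup c j)) (trans (sym (eval-x-con e (embed (lookup c j)))) eval≡0)) (sym (lookup-map j embed c))

  tilingPoint : Tiling (△ 0<n l r b) Π → Vec (𝔽 3) (#intervals n)
  tilingPoint T = tabulate (λ i → valuation l r b Π Π⊆Atomic T (#.from i))

  pointValuation-tilingPoint : ∀ T e → pointValuation (tilingPoint T) e ≡ valuation l r b Π Π⊆Atomic T e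
  pointValuation-tilingPoint T e = trans (lookup∘tabulate _ (#.to e))
    (cong (valuation l r b Π Π⊆Atomic T) (#.strictlyInverseʳ e))

  -- Holds for any set of atomic pieces with distinguishing polynomials, of which a refinement is an
  -- instance.
  variety↔tilings : Inverse (Variety I) (Tilings (△ 0<n l r b) Π)
  variety↔tilings = record
    { to        = to
    ; from      = from
    ; to-cong   = λ { {a , _} {a′ , _} → to-cong {a} {a′} }
    ; from-cong = λ {S} {T} → from-cong {S} {T}
    ; inverse   =
        (λ {T} {a} a≈ → ≐-trans (to-cong a≈) (to∘from T)) ,
        (λ {a} {T} T≈ → trans (from-cong {T} {to a} T≈) (from∘to a))
    }
    where
    V = Setoid.Carrier (Variety I)

    to : V → Tiling (△ 0<n l r b) Π
    to (a , z) = toTiling l r b Π (pointValuation a) (zero⇒filling a z)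

    from : Tiling (△ 0<n l r b) Π → V
    from T = tilingPoint T , filling⇒zero (tilingPoint T)
      (filling-cong l r b Π (sym ∘ pointValuation-tilingPoint T) (valuation-filling l r b Π Π⊆Atomic T))

    to-cong : ∀ {a a′} → a ≡ a′ → tilesOf l r b Π (pointValuation a) ≐ tilesOf l r b Π (pointValuation a′)
    to-cong refl = ≐-refl

    -- Each valuation is read from tiles picked by the `noGaps` of its own tiling. A tile picked in
    -- `T` also lies in `S`, where edge matching compares it with the one picked there.
    from-cong : ∀ {S T} → Tiling.tiles S ≐ Tiling.tiles T → tilingPoint S ≡ tilingPoint T
    from-cong {S} {T} S≐T = tabulate-cong λ i →
      let t , t∈T , t∋e = valuation-attained l r b Π Π⊆Atomic T (#.from i) in
      valuation-unique l r b Π Π⊆Atomic S (#.from i) (proj₂ S≐T t∈T) t∋e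

    to∘from : ∀ T → Tiling.tiles (to (from T)) ≐ Tiling.tiles T
    to∘from T = ≐-trans
      (tilesOf-cong l r b Π (pointValuation-tilingPoint T))
      (tilesOf-valuation l r b Π Π⊆Atomic T)

    from∘to : ∀ a → tilingPoint (to a) ≡ proj₁ a
    from∘to (a , z) = lookup-ext λ i →
      let T = to (a , z)
          t , t∈T , t∋e = valuation-attained l r b Π Π⊆Atomic T (#.from i) in
      -- Whichever tile was picked, its value on the interval is the one prescribed by
      -- `pointValuation a`.
      trans (lookup∘tabulate _ i)
      (trans (tilesOf-value l r b Π (#.from i) t∈T t∋e)
      (cong (lookup a) (#.strictlyInverseˡ i)))

-- The refined puzzle

refinement⊆Atomic : ∀ Ω (τ : AtomicTilings Ω) → refinement Ω τ ⊆ Atomic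
refinement⊆Atomic Ω τ (p , p∈Ω , v , t∈τ) = Tiling.allowed (τ p p∈Ω) t∈τ

theorem6p7 : (n k : ℕ) (0<k : 0 < k) (k≤n : k ≤ n)
    (la mu nu : Vec (𝔽 2) n) →
    ones la ≡ k → ones mu ≡ k → ones nu ≡ k →
    (Ω : Pred (Piece 2) 0ℓ) (τ : AtomicTilings Ω)
    (f↑ f↓ : Poly 3) →
    UpDistinguishing (refinement Ω τ) f↑ →
    DownDistinguishing (refinement Ω τ) f↓ →
    (numbering : Numbering n (≤-trans 0<k k≤n)) →
    Inverse (Variety (atomicPuzzleIdeal numbering la mu nu f↑ f↓))
    (Tilings (embedPiece (△ (≤-trans 0<k k≤n) la mu nu)) (refinement Ω τ))
-- `embedPiece` of the big triangle reduces to `△` with the embedded sequences, so the two types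
-- agree definitionally.
theorem6p7 n k 0<k k≤n la mu nu _ _ _ Ω τ f↑ f↓ up-dist down-dist numbering =
  variety↔tilings numbering la mu nu (refinement Ω τ) (refinement⊆Atomic Ω τ) f↑ f↓ up-dist down-dist
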